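{- If $G$ is a finite simple undirected AT-free graph having girth at least $5$, then $\mathrm{box}(G)\le 2$.
   Context: $G$ is AT-free if it has no asteroidal triple (independent set of three vertices such that between each pair there is a path avoiding the neighbourhood of the third). The girth is the length of a shortest cycle (an acyclic graph has girth at least $5$). $\mathrm{box}(G)$ is the minimum $k$ such that $G$ is the intersection graph of axis-parallel $k$-dimensional boxes, equivalently the minimum $k$ such that $G$ is the edge-intersection of $k$ interval graphs on $V(G)$. -}

module Defs where

open import Data.Nat using (ℕ; _≤_; _≥_)
open import Data.Fin using (Fin)
open import Data.List using (List; []; _∷_; length)
open import Data.List.Relation.Unary.Unique.Propositional using (Unique)
open import Data.Sum using (_⊎_)
open import Data.Product using (Σ; ∃; ∃-syntax; _×_; _,_)
open import Relation.Nullary using (¬_; Dec)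
open import Relation.Binary.PropositionalEquality using (_≡_)

record SimpleGraph (n : ℕ) : Set₁ where
  field
    Adj    : Fin n → Fin n → Set
    sym    : ∀ {u v} → Adj u v → Adj v u
    irrefl : ∀ {u} → ¬ Adj u u
    dec    : ∀ u v → Dec (Adj u v)
open SimpleGraph public

module _ {n : ℕ} (G : SimpleGraph n) where

  InClosedNbhd : Fin n → Fin n → Set
  InClosedNbhd z v = (v ≡ z) ⊎ Adj G z v

  -- A walk from x to y all of whose vertices avoid N[z].
  -- (A path exists iff a walk exists, so walks suffice.)
  data AvoidingWalk (z : Fin n) : Fin n → Fin n → Set where
    here : ∀ {x} → ¬ InClosedNbhd z x → AvoidingWalk z x x
    step : ∀ {x w y} → ¬ InClosedNbhd z x → Adj G x w →
           AvoidingWalk z w y → AvoidingWalk z x y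

  Independent3 : Fin n → Fin n → Fin n → Set
  Independent3 x y z =
    ¬ (x ≡ y) × ¬ (y ≡ z) × ¬ (x ≡ z) ×
    ¬ Adj G x y × ¬ Adj G y z × ¬ Adj G x z

  AsteroidalTriple : Fin n → Fin n → Fin n → Set
  AsteroidalTriple x y z =
    Independent3 x y z ×
    AvoidingWalk z x y × AvoidingWalk x y z × AvoidingWalk y x z

  ATFree : Set
  ATFree = ∀ x y z → ¬ AsteroidalTriple x y z

  ClosesUp : Fin n → List (Fin n) → Set
  ClosesUp first []            = Adj G first first  -- unused: lists are nonempty below
  ClosesUp first (v ∷ [])      = Adj G v first
  ClosesUp first (u ∷ v ∷ vs)  = Adj G u v × ClosesUp first (v ∷ vs)

  record Cycle : Set where
    field
      first  : Fin n
      rest   : List (Fin n)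
      unique : Unique (first ∷ rest)
      long   : 3 ≤ length (first ∷ rest)
      closes : ClosesUp first (first ∷ rest)

  cycleLength : Cycle → ℕ
  cycleLength c = length (Cycle.first c ∷ Cycle.rest c)

  -- girth ≥ g : every cycle has length ≥ g (vacuous for acyclic graphs,
  -- matching the convention that acyclic graphs have infinite girth)
  GirthAtLeast : ℕ → Set
  GirthAtLeast g = (c : Cycle) → g ≤ cycleLength c

  -- A representation of G as an intersection graph of axis-parallel
  -- k-dimensional boxes: box of v is ∏_{i<k} [lo v i , hi v i].
  -- Closed boxes intersect iff their projections intersect in every coordinate.
  BoxesMeet : (k : ℕ) → (Fin n → Fin k → ℕ) → (Fin n → Fin k → ℕ) →
              Fin n → Fin n → Set
  BoxesMeet k lo hi u v = ∀ (i : Fin k) → (lo u i ≤ hi v i) × (lo v i ≤ hi u i)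

  record BoxRep (k : ℕ) : Set where
    field
      lo    : Fin n → Fin k → ℕ
      hi    : Fin n → Fin k → ℕ
      valid : ∀ v i → lo v i ≤ hi v i
      adj⇔  : ∀ u v → ¬ (u ≡ v) →
              (Adj G u v → BoxesMeet k lo hi u v) × (BoxesMeet k lo hi u v → Adj G u v)

  BoxicityAtMost : ℕ → Set
  BoxicityAtMost b = ∃[ k ] (k ≤ b × BoxRep k)

{-# OPTIONS --safe #-}
module Submission where

-- Vertices are removed until none is left, and then put back one gadget at a
-- time.  The drawing keeps, for every vertex, a horizontal ray that leaves its
-- box to the right and meets no other box; a pendant vertex, or a pentagon
-- hanging at one vertex, can be drawn in a thin strip around such a ray.
-- If every vertex has degree at least two, then a pentagon with four vertices
-- of degree two exists.  Extend an induced path at its front p₀ by a further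
-- neighbour q of p₀.  As there are no cycles of length 3 or 4, and induced
-- cycles of length at least 6 contain asteroidal triples, this fails only when
-- q p₀ p₁ p₂ p₃ is a pentagon.  Neighbours outside it cannot be attached at two
-- adjacent vertices of it, so if the path goes on after p₃, they could otherwise
-- only sit at p₀ or p₁, and from there the path can go the long way round and
-- becomes longer.  If the path stops at p₃, two attachments give a path of six.

open import Defs
open import Data.Nat using (ℕ; zero; suc; _+_; _*_; _≤_; _<_; z≤n; s≤s; s≤s⁻¹; z<s)
open import Data.Nat.Properties using (_≤?_; _<?_; ≤-refl; ≤-reflexive; ≤-trans; <-asym; <⇒≱; ≮⇒≥; ≤-antisym; n≤1+n; m≤m+n; m≤n⇒m≤n+o; +-suc; +-comm; +-identityʳ; +-mono-≤; +-monoʳ-≤; +-monoʳ-<; +-cancelˡ-≤; *-suc; *-monoʳ-≤; *-cancelˡ-<; module ≤-Reasoning)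
open import Data.Nat.Induction using (<-wellFounded)
open import Data.Fin using (Fin; zero; suc)
import Data.Fin as Fin
open import Data.Fin.Properties using (_≟_; any?; pigeonhole)
open import Data.List using (List; []; _∷_; length; filter; lookup; allFin)
open import Data.List.Properties using (filter-notAll)
open import Data.List.Membership.Propositional using (_∈_; lose)
open import Data.List.Membership.Propositional.Properties using (∈-filter⁺; ∈-filter⁻; ∈-allFin; ∈-lookup)
open import Data.List.Relation.Unary.All using (All; []; _∷_)
import Data.List.Relation.Unary.All as All
open import Data.List.Relation.Unary.Any using (here; there)
open import Data.List.Relation.Unary.AllPairs using ([]; _∷_)
open import Data.Product using (∃; _×_; _,_; proj₁; proj₂)
open import Data.Sum using (_⊎_; inj₁; inj₂; [_,_]′)
open import Data.Empty using (⊥; ⊥-elim)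
open import Function using (_∘_)
open import Induction.WellFounded using (Acc; acc)
open import Relation.Nullary using (¬_; Dec; yes; no; contradiction)
open import Relation.Nullary.Decidable using (¬?; _×-dec_; _→-dec_; _⊎-dec_; toWitness; toWitnessFalse; decidable-stable; True; False)
open import Relation.Binary.PropositionalEquality using (_≡_; _≢_; refl; trans; cong; subst; ≢-sym) renaming (sym to ≡-sym)

-- Boxes with a ray, and new boxes drawn around one ray.

record Box : Set where
  constructor box
  field
    x₁ x₂ y₁ y₂ ray : ℕ
open Box

record Valid (b : Box) : Set where
  constructor valid
  field
    x₁≤x₂  : x₁ b ≤ x₂ b
    y₁≤ray : y₁ b ≤ ray b
    ray≤y₂ : ray b ≤ y₂ b
open Valid

Meet : Box → Box → Set
Meet b c = (x₁ b ≤ x₂ c × x₁ c ≤ x₂ b) × (y₁ b ≤ y₂ c × y₁ c ≤ y₂ b)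

-- The ray leaving b from its right side at height `ray b` misses c.
Clear : Box → Box → Set
Clear b c = y₁ c ≤ ray b → ray b ≤ y₂ c → x₂ c < x₂ b

-- `A` stands for adjacency, which keeps the geometry free of graphs. Only the ray of `b` is tested
-- here; the ray of `c` is covered by the pair in the other order.
record Fits (A : Set) (b c : Box) : Set where
  constructor fits
  field
    to    : A → Meet b c
    from  : Meet b c → A
    clear : Clear b c
open Fits

-- Every row becomes a block of six rows; the ray takes the lowest one.
scale : Box → Box
scale b = box (x₁ b) (x₂ b) (6 * y₁ b + 0) (6 * y₂ b + 5) (6 * ray b + 0)

-- The box l, drawn at the right side of b inside the block of the ray of b.
place : Box → Box → Box
place b l = box (x₂ b + x₁ l) (x₂ b + x₂ l) (6 * ray b + y₁ l) (6 * ray b + y₂ l) (6 * ray b + ray l)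

-- Row 0 of the block stays free for the ray of the base, and `x₂>0` makes the new ray start to the
-- right of the base.
record Local (l : Box) : Set where
  constructor local
  field
    l-valid : Valid l
    x₂>0    : 0 < x₂ l
    y₁>0    : 0 < y₁ l
    y₂≤5    : y₂ l ≤ 5
open Local

-- A remainder of at most 5 cannot reach the next block.
block-≤⁻ : ∀ a b {r s} → s ≤ 5 → 6 * a + r ≤ 6 * b + s → a ≤ b
block-≤⁻ a b {r} {s} s≤5 le = s≤s⁻¹ (*-cancelˡ-< 6 a (suc b) (begin-strict
  6 * a      ≤⟨ m≤m+n (6 * a) r ⟩
  6 * a + r  ≤⟨ le ⟩
  6 * b + s  ≤⟨ +-monoʳ-≤ (6 * b) s≤5 ⟩
  6 * b + 5  <⟨ ≤-reflexive (≡-sym (+-suc (6 * b) 5)) ⟩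
  6 * b + 6  ≡⟨ +-comm (6 * b) 6 ⟩
  6 + 6 * b  ≡⟨ *-suc 6 b ⟨
  6 * suc b  ∎))
  where open ≤-Reasoning

block-≤⁺ : ∀ {a b r s} → a ≤ b → r ≤ s → 6 * a + r ≤ 6 * b + s
block-≤⁺ a≤b = +-mono-≤ (*-monoʳ-≤ 6 a≤b)

scale-valid : ∀ {b} → Valid b → Valid (scale b)
scale-valid (valid x l r) = valid x (block-≤⁺ l z≤n) (block-≤⁺ r z≤n)

place-valid : ∀ b {l} → Valid l → Valid (place b l)
place-valid b (valid x l r) = valid (+-monoʳ-≤ (x₂ b) x) (+-monoʳ-≤ (6 * ray b) l) (+-monoʳ-≤ (6 * ray b) r)

scale-fits : ∀ {A b c} → Fits A b c → Fits A (scale b) (scale c)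
scale-fits {A} {b} {c} (fits to from clear) = fits
  (λ a → let x , (p , q) = to a in x , block-≤⁺ p z≤n , block-≤⁺ q z≤n)
  (λ (x , (p , q)) → from (x , block-≤⁻ (y₁ b) (y₂ c) ≤-refl p , block-≤⁻ (y₁ c) (y₂ b) ≤-refl q))
  (λ p q → clear (block-≤⁻ (y₁ c) (ray b) z≤n p) (block-≤⁻ (ray b) (y₂ c) ≤-refl q))

place-fits : ∀ {A} b {l m} → Fits A l m → Fits A (place b l) (place b m)
place-fits b (fits to from clear) = fits
  (λ a → let (p , q) , (r , s) = to a in
    (+-monoʳ-≤ x p , +-monoʳ-≤ x q) , (+-monoʳ-≤ y r , +-monoʳ-≤ y s))
  (λ ((p , q) , (r , s)) → from
    ((+-cancelˡ-≤ x _ _ p , +-cancelˡ-≤ x _ _ q) , (+-cancelˡ-≤ y _ _ r , +-cancelˡ-≤ y _ _ s)))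
  (λ p q → +-monoʳ-< x (clear (+-cancelˡ-≤ y _ _ p) (+-cancelˡ-≤ y _ _ q)))
  where
  x = x₂ b
  y = 6 * ray b

module _ {A : Set} {b l : Box} (vb : Valid b) (L : Local l) (to₀ : A → x₁ l ≡ 0) (from₀ : x₁ l ≡ 0 → A) where

  private
    hit : A → Meet (scale b) (place b l)
    hit a = (m≤n⇒m≤n+o (x₂ l) (x₁≤x₂ vb) , ≤-reflexive (trans (cong (x₂ b +_) (to₀ a)) (+-identityʳ (x₂ b))))
          , (block-≤⁺ (y₁≤ray vb) z≤n
          , block-≤⁺ (ray≤y₂ vb) (≤-trans (≤-trans (y₁≤ray (l-valid L)) (ray≤y₂ (l-valid L))) (y₂≤5 L)))

    touch : x₂ b + x₁ l ≤ x₂ b → A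
    touch p = from₀ (≤-antisym (+-cancelˡ-≤ (x₂ b) _ _ (≤-trans p (≤-reflexive (≡-sym (+-identityʳ (x₂ b)))))) z≤n)

  -- The whole block of the ray of `b` belongs to the rows of `scale b`, so the left end of `l`
  -- alone decides whether the boxes meet.
  base-fits-new : Fits A (scale b) (place b l)
  base-fits-new = fits hit (λ ((_ , p) , _) → touch p)
    (λ p _ → contradiction (+-cancelˡ-≤ (6 * ray b) _ _ p) (<⇒≱ (y₁>0 L)))

  new-fits-base : Fits A (place b l) (scale b)
  new-fits-base = fits
    (λ a → let (p , q) , (r , s) = hit a in (q , p) , (s , r))
    (λ ((p , _) , _) → touch p)
    (λ _ _ → subst (_< x₂ b + x₂ l) (+-identityʳ (x₂ b)) (+-monoʳ-< (x₂ b) (x₂>0 L)))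

module _ {A : Set} {b c l : Box} (vc : Valid c) (L : Local l) (b-clear : Clear b c) (c-clear : Clear c b) (¬a : ¬ A) where

  private
    -- Sharing a row with the new box means that `c` contained the row of the ray of `b` before
    -- scaling; being clear of that ray, it ends before the new box begins.
    left : 6 * y₁ c + 0 ≤ 6 * ray b + y₂ l → 6 * ray b + y₁ l ≤ 6 * y₂ c + 5 → x₂ c < x₂ b
    left p q = b-clear (block-≤⁻ (y₁ c) (ray b) (y₂≤5 L) p) (block-≤⁻ (ray b) (y₂ c) ≤-refl q)

    miss : x₂ b + x₁ l ≤ x₂ c → 6 * y₁ c + 0 ≤ 6 * ray b + y₂ l → 6 * ray b + y₁ l ≤ 6 * y₂ c + 5 → ⊥
    miss p q r = <⇒≱ (left q r) (≤-trans (m≤m+n (x₂ b) (x₁ l)) p)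

  old-fits-new : Valid b → Fits A (scale c) (place b l)
  old-fits-new vb = fits (⊥-elim ∘ ¬a) (λ ((_ , p) , (q , r)) → ⊥-elim (miss p q r)) λ p q →
    -- Equal rays would each have to start to the right of the other.
    let b≤c = block-≤⁻ (ray b) (ray c) z≤n p
        c≤b = block-≤⁻ (ray c) (ray b) (y₂≤5 L) q
    in contradiction (b-clear (≤-trans (y₁≤ray vc) c≤b) (≤-trans b≤c (ray≤y₂ vc)))
         (<-asym (c-clear (≤-trans (y₁≤ray vb) b≤c) (≤-trans c≤b (ray≤y₂ vb))))

  new-fits-old : Fits A (place b l) (scale c)
  new-fits-old = fits (⊥-elim ∘ ¬a) (λ ((p , _) , (r , q)) → ⊥-elim (miss p q r)) λ p q →
    ≤-trans (left (≤-trans p (+-monoʳ-≤ (6 * ray b) (ray≤y₂ (l-valid L))))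
                  (≤-trans (+-monoʳ-≤ (6 * ray b) (y₁≤ray (l-valid L))) q))
            (m≤m+n (x₂ b) (x₂ l))

meet? : ∀ b c → Dec (Meet b c)
meet? b c = (x₁ b ≤? x₂ c ×-dec x₁ c ≤? x₂ b) ×-dec (y₁ b ≤? y₂ c ×-dec y₁ c ≤? y₂ b)

clear? : ∀ b c → Dec (Clear b c)
clear? b c = (y₁ c ≤? ray b) →-dec ((ray b ≤? y₂ c) →-dec (x₂ c <? x₂ b))

-- On concrete boxes both decisions evaluate, so the hidden arguments need not be given.
fits-meet : ∀ {A} b c {_ : True (meet? b c)} {_ : True (clear? b c)} → A → Fits A b c
fits-meet b c {m} {k} a = fits (λ _ → toWitness m) (λ _ → a) (toWitness k)

fits-apart : ∀ {A} b c {_ : False (meet? b c)} {_ : True (clear? b c)} → ¬ A → Fits A b c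
fits-apart b c {m} {k} ¬a = fits (⊥-elim ∘ ¬a) (⊥-elim ∘ toWitnessFalse m) (toWitness k)

-- Layouts of vertex sets, and gluing a gadget to a layout.

module _ {n : ℕ} (G : SimpleGraph n) where

  private
    V : Set
    V = Fin n

    _~_ _≁_ : V → V → Set
    u ~ v = Adj G u v
    u ≁ v = ¬ (u ~ v)

    infix 4 _~_ _≁_

  open import Data.List.Membership.DecPropositional (_≟_ {n}) using (_∈?_)

  ~⇒≢ : ∀ {u v} → u ~ v → u ≢ v
  ~⇒≢ u~v refl = irrefl G u~v

  -- A drawing of the subgraph induced by `S`. The graph `G` stays fixed, so girth and AT-freeness
  -- never have to be transferred to subgraphs.
  record Layout (S : List V) : Set where
    field
      boxOf  : V → Box
      valids : ∀ {v} → v ∈ S → Valid (boxOf v)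
      fit    : ∀ {u v} → u ∈ S → v ∈ S → u ≢ v → Fits (u ~ v) (boxOf u) (boxOf v)
  open Layout

  module _ {m : ℕ} (c : Fin m → V) where

    new? : (u : V) → Dec (∃ λ i → u ≡ c i)
    new? u = any? λ i → u ≟ c i

    remove : List V → List V
    remove = filter (¬? ∘ new?)

  remove-shorter : ∀ {m} (c : Fin m → V) S i → c i ∈ S → length (remove c S) < length S
  remove-shorter c S i i∈ = filter-notAll (¬? ∘ new? c) S (lose i∈ λ notNew → notNew (i , refl))

  record Gadget {m : ℕ} (c : Fin m → V) (l : Fin m → Box) (S : List V) (v : V) : Set where
    field
      v-old   : v ∈ remove c S
      locals  : ∀ i → Local (l i)
      inner   : ∀ i j → i ≢ j → Fits (c i ~ c j) (l i) (l j)
      touch⁺  : ∀ i → c i ~ v → x₁ (l i) ≡ 0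
      touch⁻  : ∀ i → x₁ (l i) ≡ 0 → c i ~ v
      outer   : ∀ i {u} → u ∈ remove c S → u ≢ v → c i ≁ u

  module _ {m : ℕ} {c : Fin m → V} {l : Fin m → Box} {S : List V} {v : V}
           (g : Gadget c l S v) (R : Layout (remove c S)) where
    open Gadget g

    private
      b : Box
      b = boxOf R v

      vb : Valid b
      vb = valids R v-old

      attached : V → Box
      attached u with new? c u
      ... | yes (i , _) = place b (l i)
      ... | no  _       = scale (boxOf R u)

      -- A view on `attached`: indexing by the box lets one match reveal both the kind of the vertex
      -- and its box.
      data Origin (u : V) : Box → Set where
        new : ∀ i → u ≡ c i → Origin u (place b (l i))
        old : u ∈ remove c S → Origin u (scale (boxOf R u))

      origin : ∀ {u} → u ∈ S → Origin u (attached u)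
      origin {u} u∈S with new? c u
      ... | yes (i , u≡) = new i u≡
      ... | no  ¬new     = old (∈-filter⁺ (¬? ∘ new? c) u∈S ¬new)

      origin-valid : ∀ {u d} → Origin u d → Valid d
      origin-valid (new i _)  = place-valid b (l-valid (locals i))
      origin-valid (old u∈)   = scale-valid (valids R u∈)

      origin-fits : ∀ {u w d e} → Origin u d → Origin w e → u ≢ w → Fits (u ~ w) d e
      origin-fits (new i refl) (new j refl) u≢w = place-fits b (inner i j λ { refl → u≢w refl })
      origin-fits (old u∈) (old w∈) u≢w = scale-fits (fit R u∈ w∈ u≢w)
      origin-fits {w = w} (new i refl) (old w∈) u≢w with w ≟ v
      ... | yes refl = new-fits-base vb (locals i) (touch⁺ i) (touch⁻ i)
      ... | no  w≢v  = new-fits-old {b = b} (valids R w∈) (locals i)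
                         (clear (fit R v-old w∈ (≢-sym w≢v))) (clear (fit R w∈ v-old w≢v)) (outer i w∈ w≢v)
      origin-fits {u} (old u∈) (new i refl) u≢w with u ≟ v
      ... | yes refl = base-fits-new vb (locals i) (touch⁺ i ∘ sym G) (sym G ∘ touch⁻ i)
      ... | no  u≢v  = old-fits-new {b = b} (valids R u∈) (locals i)
                         (clear (fit R v-old u∈ (≢-sym u≢v))) (clear (fit R u∈ v-old u≢v)) (outer i u∈ u≢v ∘ sym G) vb

    attach : Layout S
    attach = record
      { boxOf  = attached
      ; valids = λ v∈ → origin-valid (origin v∈)
      ; fit    = λ u∈ v∈ → origin-fits (origin u∈) (origin v∈)
      }

  isolate : ∀ {S w} → (∀ {u} → u ∈ S → u ≡ w) → Layout S
  isolate only = record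
    { boxOf  = λ _ → box 0 0 0 0 0
    ; valids = λ _ → valid z≤n z≤n z≤n
    ; fit    = λ u∈ v∈ u≢v → contradiction (trans (only u∈) (≡-sym (only v∈))) u≢v
    }

  -- Vertices of degree at most one.

  module _ {S : List V} {w : V} where

    private
      single : Fin 1 → V
      single _ = w

      S′ : List V
      S′ = remove single S

    attach-leaf : ∀ {v} → v ∈ S′ → (∀ {q} → q ∈ S′ → w ~ q → q ≡ v) → Layout S′ → Layout S
    attach-leaf {v} v∈ only with dec G w v
    ... | yes w~v = attach {l = λ _ → box 0 1 1 1 1} record
      { v-old  = v∈
      ; locals = λ _ → local (valid z≤n ≤-refl ≤-refl) ≤-refl ≤-refl (s≤s z≤n)
      ; inner  = λ { zero zero 0≢0 → contradiction refl 0≢0 }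
      ; touch⁺ = λ _ _ → refl
      ; touch⁻ = λ _ _ → w~v
      ; outer  = λ _ u∈ u≢v w~u → u≢v (only u∈ w~u)
      }
    -- Left end 1 leaves a gap, so an isolated `w` is drawn beside `v` without touching it.
    ... | no  w≁v = attach {l = λ _ → box 1 1 1 1 1} record
      { v-old  = v∈
      ; locals = λ _ → local (valid ≤-refl ≤-refl ≤-refl) ≤-refl ≤-refl (s≤s z≤n)
      ; inner  = λ { zero zero 0≢0 → contradiction refl 0≢0 }
      ; touch⁺ = λ _ w~v → contradiction w~v w≁v
      ; touch⁻ = λ _ ()
      ; outer  = λ _ u∈ u≢v w~u → u≢v (only u∈ w~u)
      }

    -- If `a` is missing from `S′`, then `w` has no neighbour there and any vertex of `S′` can serve
    -- as base; only an empty `S′` offers none.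
    leaf-layout : ∀ {a} → (∀ {q} → q ∈ S → w ~ q → q ≡ a) → Layout S′ → Layout S
    leaf-layout {a} only R with a ∈? S′
    ... | yes a∈ = attach-leaf a∈ (λ q∈ → only (proj₁ (∈-filter⁻ (¬? ∘ new? single) q∈))) R
    ... | no  a∉ with any? (_∈? S′)
    ...   | yes (v , v∈) = attach-leaf v∈ (λ q∈ w~q → contradiction (subst (_∈ S′)
                             (only (proj₁ (∈-filter⁻ (¬? ∘ new? single) q∈)) w~q) q∈) a∉) R
    ...   | no  empty = isolate λ {u} u∈ → decidable-stable (u ≟ w) λ u≢w →
                          empty (u , ∈-filter⁺ (¬? ∘ new? single) u∈ (u≢w ∘ proj₂))

  -- Pentagons and induced paths.

  record Pentagon (S : List V) (a b c d e : V) : Set where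
    constructor pentagon
    field
      a~b : a ~ b
      b~c : b ~ c
      c~d : c ~ d
      d~e : d ~ e
      e~a : e ~ a
      a∈  : a ∈ S
      b∈  : b ∈ S
      c∈  : c ∈ S
      d∈  : d ∈ S
      e∈  : e ∈ S

  rotate : ∀ {S a b c d e} → Pentagon S a b c d e → Pentagon S b c d e a
  rotate (pentagon ab bc cd de ea a b c d e) = pentagon bc cd de ea ab b c d e a

  reflect : ∀ {S a b c d e} → Pentagon S a b c d e → Pentagon S a e d c b
  reflect (pentagon ab bc cd de ea a b c d e) =
    pentagon (sym G ea) (sym G de) (sym G cd) (sym G bc) (sym G ab) a e d c b

  Extra : List V → V → V → V → V → Set
  Extra S c a b x = x ∈ S × c ~ x × x ≢ a × x ≢ b

  DegreeTwo : List V → V → V → V → Set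
  DegreeTwo S c a b = ∀ {x} → x ∈ S → c ~ x → x ≡ a ⊎ x ≡ b

  extra? : ∀ S c a b → (∃ λ x → Extra S c a b x) ⊎ DegreeTwo S c a b
  extra? S c a b with any? (λ x → (x ∈? S) ×-dec (dec G c x ×-dec (¬? (x ≟ a) ×-dec ¬? (x ≟ b))))
  ... | yes found = inj₁ found
  ... | no  none  = inj₂ λ {x} x∈ c~x → decidable-stable ((x ≟ a) ⊎-dec (x ≟ b))
                      λ neither → none (x , x∈ , c~x , neither ∘ inj₁ , neither ∘ inj₂)

  -- Only `a` may have neighbours in `S` outside the pentagon, so the other four vertices form a
  -- gadget at `a`.
  record EndPentagon (S : List V) : Set where
    constructor endPentagon
    field
      {a b c d e} : V
      cycle : Pentagon S a b c d e
      deg-b : DegreeTwo S b a c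
      deg-c : DegreeTwo S c b d
      deg-d : DegreeTwo S d c e
      deg-e : DegreeTwo S e d a

  extra-swap : ∀ {S c a b x} → Extra S c a b x → Extra S c b a x
  extra-swap (x∈ , c~x , x≢a , x≢b) = x∈ , c~x , x≢b , x≢a

  data InducedPath : List V → Set where
    one  : ∀ {v} → InducedPath (v ∷ [])
    cons : ∀ {u v vs} → u ~ v → All (λ w → u ≁ w × u ≢ w) vs →
           InducedPath (v ∷ vs) → InducedPath (u ∷ v ∷ vs)

  path-distinct : ∀ {vs} → InducedPath vs → ∀ {i j} → i Fin.< j → lookup vs i ≢ lookup vs j
  path-distinct one {zero} {suc ()}
  path-distinct one {suc ()}
  path-distinct (cons u~v _ _)   {zero}  {suc zero}    _ = ~⇒≢ u~v
  path-distinct (cons _ far _)   {zero}  {suc (suc j)} _ = proj₂ (All.lookup far (∈-lookup j))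
  path-distinct (cons _ _ p)     {suc i} {suc j}     i<j = path-distinct p (s≤s⁻¹ i<j)

  path-length : ∀ {vs} → InducedPath vs → length vs ≤ n
  path-length {vs} p = ≮⇒≥ λ n<len →
    let _ , _ , i<j , eq = pigeonhole n<len (lookup vs) in path-distinct p i<j eq

  record PathIn (S : List V) (k : ℕ) : Set where
    constructor pathIn
    field
      {vertices} : List V
      path       : InducedPath vertices
      inside     : All (_∈ S) vertices
      long       : k ≤ length vertices

  avoid : ∀ {z v} → v ≢ z → z ≁ v → ¬ InClosedNbhd G z v
  avoid v≢z _   (inj₁ v≡z) = v≢z v≡z
  avoid _   z≁v (inj₂ z~v) = z≁v z~v

  -- Follows the path as far as `r` and then steps to `q`: the long arc in `no-long-cycle`.
  along : ∀ {z q v vs r} → InducedPath (v ∷ vs) → All (¬_ ∘ InClosedNbhd G z) (v ∷ vs) →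
          ¬ InClosedNbhd G z q → r ∈ v ∷ vs → q ~ r → AvoidingWalk G z v q
  along _ (nv ∷ _) nq (here refl) q~v = step nv (sym G q~v) (here nq)
  along (cons v~w _ p) (nv ∷ ns) nq (there r∈) q~r = step nv v~w (along p ns nq r∈ q~r)

  -- Configurations excluded by girth and AT-freeness.

  module _ (atFree : ATFree G) (girth : GirthAtLeast G 5) where

    no-triangle : ∀ {a b c} → a ~ b → b ~ c → c ~ a → ⊥
    no-triangle {a} {b} {c} ab bc ca with girth (record
      { first  = a
      ; rest   = b ∷ c ∷ []
      ; unique = (~⇒≢ ab ∷ ≢-sym (~⇒≢ ca) ∷ []) ∷ (~⇒≢ bc ∷ []) ∷ [] ∷ []
      ; long   = ≤-refl
      ; closes = ab , bc , ca
      })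
    ... | s≤s (s≤s (s≤s ()))

    no-square : ∀ {a b c d} → a ~ b → b ~ c → c ~ d → d ~ a → a ≢ c → b ≢ d → ⊥
    no-square {a} {b} {c} {d} ab bc cd da a≢c b≢d with girth (record
      { first  = a
      ; rest   = b ∷ c ∷ d ∷ []
      ; unique = (~⇒≢ ab ∷ a≢c ∷ ≢-sym (~⇒≢ da) ∷ []) ∷ (~⇒≢ bc ∷ b≢d ∷ []) ∷ (~⇒≢ cd ∷ []) ∷ [] ∷ []
      ; long   = s≤s (s≤s (s≤s z≤n))
      ; closes = ab , bc , cd , da
      })
    ... | s≤s (s≤s (s≤s (s≤s ())))

    module _ {S a b c d e} (P : Pentagon S a b c d e) where
      open Pentagon P

      chord : a ≁ c
      chord ac = no-triangle a~b b~c (sym G ac)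

      opposite : a ≢ c
      opposite refl = no-triangle c~d d~e e~a

      extra-near : ∀ {x} → Extra S a b e x → x ≁ b
      extra-near (_ , a~x , _) x~b = no-triangle a~x x~b (sym G a~b)

      -- Otherwise `a`, `x`, `c`, `b` form a square. Applied to the reflected pentagon, this also
      -- keeps `x` off `d`.
      extra-far : ∀ {x} → Extra S a b e x → x ≁ c
      extra-far (_ , a~x , x≢b , _) x~c =
        no-square a~x x~c (sym G b~c) (sym G a~b) opposite x≢b

    -- Otherwise p₃, p₁, q is an asteroidal triple.
    no-long-cycle : ∀ {p₀ p₁ p₂ p₃ vs q} → InducedPath (p₀ ∷ p₁ ∷ p₂ ∷ p₃ ∷ vs) →
                    q ~ p₀ → q ≁ p₁ → q ≁ p₂ → q ≁ p₃ → ∀ {r} → r ∈ vs → q ≁ r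
    no-long-cycle {p₀} {p₁} {p₂} {p₃} {vs} {q}
      (cons p₀~p₁ ((p₀≁p₂ , _) ∷ (p₀≁p₃ , p₀≢p₃) ∷ _) (cons p₁~p₂ ((p₁≁p₃ , p₁≢p₃) ∷ far₁) (cons p₂~p₃ _ P₃)))
      q~p₀ q≁p₁ q≁p₂ q≁p₃ r∈ q~r = atFree p₃ p₁ q
        ( ( ≢-sym p₁≢p₃ , ≢-sym q≢p₁ , ≢-sym q≢p₃ , p₁≁p₃ ∘ sym G , q≁p₁ ∘ sym G , q≁p₃ ∘ sym G )
        , step (avoid (≢-sym q≢p₃) q≁p₃) (sym G p₂~p₃)
            (step (avoid (≢-sym q≢p₂) q≁p₂) (sym G p₁~p₂) (here (avoid (≢-sym q≢p₁) q≁p₁)))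
        , step (avoid p₁≢p₃ (p₁≁p₃ ∘ sym G)) (sym G p₀~p₁)
            (step (avoid p₀≢p₃ (p₀≁p₃ ∘ sym G)) (sym G q~p₀) (here (avoid q≢p₃ (q≁p₃ ∘ sym G))))
        -- Any neighbour `r` of `q` beyond `p₃` will do, not only the first: this walk has only to
        -- stay away from `p₁`.
        , along P₃ (All.map (λ (p₁≁w , p₁≢w) → avoid (≢-sym p₁≢w) p₁≁w) ((p₁≁p₃ , p₁≢p₃) ∷ far₁))
            (avoid q≢p₁ (q≁p₁ ∘ sym G)) (there r∈) q~r
        )
      where
      q≢p₁ : q ≢ p₁
      q≢p₁ refl = q≁p₂ p₁~p₂
      q≢p₂ : q ≢ p₂
      q≢p₂ refl = p₀≁p₂ (sym G q~p₀)
      q≢p₃ : q ≢ p₃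
      q≢p₃ refl = p₀≁p₃ (sym G q~p₀)

    -- Otherwise x, y, d is an asteroidal triple.
    no-adjacent-extras : ∀ {S a b c d e x y} → Pentagon S a b c d e →
                         Extra S a b e x → Extra S b a c y → ⊥
    no-adjacent-extras {S} {a} {b} {c} {d} {e} {x} {y} P X@(_ , a~x , x≢b , x≢e) Y@(_ , b~y , y≢a , y≢c) =
      atFree x y d
        ( ( x≢y , y≢d , x≢d , x≁y , y≁d , x≁d )
        , step (avoid x≢d (x≁d ∘ sym G)) (sym G a~x) (step (avoid a≢d (a≁d ∘ sym G)) a~b
            (step (avoid b≢d (b≁d ∘ sym G)) b~y (here (avoid y≢d (y≁d ∘ sym G)))))
        , step (avoid (≢-sym x≢y) x≁y) (sym G b~y) (step (avoid (≢-sym x≢b) x≁b) b~c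
            (step (avoid c≢x x≁c) c~d (here (avoid (≢-sym x≢d) x≁d))))
        , step (avoid x≢y (x≁y ∘ sym G)) (sym G a~x) (step (avoid (≢-sym y≢a) y≁a) (sym G e~a)
            (step (avoid e≢y y≁e) (sym G d~e) (here (avoid (≢-sym y≢d) y≁d))))
        )
      where
      open Pentagon P
      P′ = reflect P
      Q  = rotate P
      Q′ = reflect Q
      a≁d = chord P′
      a≢d = opposite P′
      b≁d = chord Q
      b≢d = opposite Q
      x≁b = extra-near P X
      x≁c = extra-far P X
      x≁d = extra-far P′ (extra-swap X)
      y≁a = extra-near Q′ Y
      y≁e = extra-far Q′ Y
      y≁d = extra-far Q (extra-swap Y)
      x≢y : x ≢ y
      x≢y refl = x≁b (sym G b~y)
      x≁y : x ≁ y
      x≁y x~y = no-square a~x x~y (sym G b~y) (sym G a~b) (≢-sym y≢a) x≢b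
      x≢d : x ≢ d
      x≢d refl = a≁d a~x
      y≢d : y ≢ d
      y≢d refl = b≁d b~y
      c≢x : c ≢ x
      c≢x refl = chord P a~x
      e≢y : e ≢ y
      e≢y refl = chord Q′ b~y

    -- The tail leaves the pentagon at a, an extra neighbour x at c; going
    -- round the long way gives a path with one vertex more than d c b a t … .
    detour : ∀ {S a b c d e t ts x} → Pentagon S a b c d e → InducedPath (a ∷ t ∷ ts) →
             All (λ w → w ∈ S × w ≢ b × w ≢ c × w ≢ d × w ≢ e) (t ∷ ts) →
             Extra S c b d x → PathIn S (6 + length ts)
    detour {S} {a} {b} {c} {d} {e} {t} {ts} {x} P path@(cons a~t a-far _) off@((t∈ , t≢b , t≢c , t≢d , t≢e) ∷ _) X@(x∈ , c~x , x≢b , x≢d) =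
      pathIn path-x (x∈ ∷ c∈ ∷ d∈ ∷ e∈ ∷ a∈ ∷ All.map proj₁ off) ≤-refl
      where
      open Pentagon P
      P′ = reflect P
      C  = rotate (rotate P)
      C′ = reflect C

      T : Extra S a e b t
      T = t∈ , a~t , t≢e , t≢b

      -- `a` already carries `t`, so the adjacent vertex `e` carries no vertex of the tail. In the
      -- same way `x` at `c` keeps the tail off `d`.
      e-far : All (λ w → e ≁ w × e ≢ w) (t ∷ ts)
      e-far = All.tabulate λ w∈ → let (w∈S , _ , _ , w≢d , w≢e) = All.lookup off w∈ in
        (λ e~w → no-adjacent-extras P′ T (w∈S , e~w , w≢a w∈ , w≢d)) , ≢-sym w≢e
        where
        w≢a : ∀ {w} → w ∈ t ∷ ts → w ≢ a
        w≢a (here refl) = ≢-sym (~⇒≢ a~t)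
        w≢a (there w∈)  = ≢-sym (proj₂ (All.lookup a-far w∈))

      path-e : InducedPath (e ∷ a ∷ t ∷ ts)
      path-e = cons e~a e-far path

      d-far : All (λ w → d ≁ w × d ≢ w) (t ∷ ts)
      d-far = All.map (λ (w∈S , _ , w≢c , w≢d , w≢e) →
        (λ d~w → no-adjacent-extras C (extra-swap X) (w∈S , d~w , w≢c , w≢e)) , ≢-sym w≢d) off

      path-d : InducedPath (d ∷ e ∷ a ∷ t ∷ ts)
      path-d = cons d~e ((chord P′ ∘ sym G , ≢-sym (opposite P′)) ∷ d-far) path-e

      c≁t : c ≁ t
      c≁t c~t = no-square a~t (sym G c~t) (sym G b~c) (sym G a~b) (opposite P) t≢b

      -- Such an edge would close a cycle of length at least six through `c`, `d`, `e`, `a`, `t`.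
      c≁ts : ∀ {w} → w ∈ ts → c ≁ w
      c≁ts = no-long-cycle path-d c~d (chord C) (chord P ∘ sym G) c≁t

      c-far : All (λ w → c ≁ w × c ≢ w) (t ∷ ts)
      c-far = All.tabulate λ w∈ →
        c≁ w∈ , ≢-sym (proj₁ (proj₂ (proj₂ (All.lookup off w∈))))
        where
        c≁ : ∀ {w} → w ∈ t ∷ ts → c ≁ w
        c≁ (here refl) = c≁t
        c≁ (there w∈)  = c≁ts w∈

      path-c : InducedPath (c ∷ d ∷ e ∷ a ∷ t ∷ ts)
      path-c = cons c~d ((chord C , opposite C) ∷ (chord P ∘ sym G , ≢-sym (opposite P)) ∷ c-far) path-d

      x≁d = extra-near C (extra-swap X)
      x≁e = extra-far C (extra-swap X)
      x≁a = extra-far C′ X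

      path-x : InducedPath (x ∷ c ∷ d ∷ e ∷ a ∷ t ∷ ts)
      path-x = cons (sym G c~x)
        ( (x≁d , x≢d)
        ∷ (x≁e , λ { refl → chord C c~x })
        ∷ (x≁a , λ { refl → chord P (sym G c~x) })
        ∷ All.tabulate λ w∈ →
            no-long-cycle path-c (sym G c~x) x≁d x≁e x≁a w∈ , λ { refl → proj₁ (All.lookup c-far w∈) c~x })
        path-c

    -- The neighbour `t` of `a` rules out extra neighbours at `b` and `e`; one at `c` or `d` allows
    -- a detour, in one direction or the other.
    hanging-pentagon : ∀ {S a b c d e t ts} → Pentagon S a b c d e → InducedPath (a ∷ t ∷ ts) →
                       All (λ w → w ∈ S × w ≢ b × w ≢ c × w ≢ d × w ≢ e) (t ∷ ts) →
                       EndPentagon S ⊎ PathIn S (6 + length ts)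
    hanging-pentagon {S} {a} {b} {c} {d} {e} P path@(cons a~t _ _) off@((t∈ , t≢b , _ , _ , t≢e) ∷ _)
      with extra? S b a c | extra? S c b d | extra? S d c e | extra? S e d a
    ... | inj₁ (_ , Y) | _ | _ | _ = ⊥-elim (no-adjacent-extras P (t∈ , a~t , t≢b , t≢e) Y)
    ... | _ | inj₁ (_ , X) | _ | _ = inj₂ (detour P path off X)
    ... | _ | _ | inj₁ (_ , X) | _ = inj₂ (detour (reflect P) path
      (All.map (λ (w∈ , w≢b , w≢c , w≢d , w≢e) → w∈ , w≢e , w≢d , w≢c , w≢b) off) (extra-swap X))
    ... | _ | _ | _ | inj₁ (_ , Y) =
      ⊥-elim (no-adjacent-extras (reflect P) (t∈ , a~t , t≢e , t≢b) (extra-swap Y))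
    ... | inj₂ db | inj₂ dc | inj₂ dd | inj₂ de = inj₁ (endPentagon P db dc dd de)

    pentagon-with-extra : ∀ {S a b c d e x} → Pentagon S a b c d e → Extra S a e b x →
                          EndPentagon S ⊎ PathIn S 6
    pentagon-with-extra P (x∈ , a~x , x≢e , x≢b) = hanging-pentagon P (cons a~x [] one)
      ((x∈ , x≢b , (λ { refl → chord P a~x }) , (λ { refl → chord (reflect P) a~x }) , x≢e) ∷ [])

    -- There is no tail yet: an extra neighbour at `b`, `c`, `d` or `e` becomes one after a
    -- rotation. If there is none, the pentagon already hangs at `a`.
    some-pentagon : ∀ {S a b c d e} → Pentagon S a b c d e → EndPentagon S ⊎ PathIn S 6
    some-pentagon {S} {a} {b} {c} {d} {e} P
      with extra? S b a c | extra? S c b d | extra? S d c e | extra? S e d a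
    ... | inj₁ (_ , X) | _ | _ | _ = pentagon-with-extra (rotate P) X
    ... | _ | inj₁ (_ , X) | _ | _ = pentagon-with-extra (rotate (rotate P)) X
    ... | _ | _ | inj₁ (_ , X) | _ = pentagon-with-extra (rotate (rotate (rotate P))) X
    ... | _ | _ | _ | inj₁ (_ , X) = pentagon-with-extra (rotate (rotate (rotate (rotate P)))) X
    ... | inj₂ db | inj₂ dc | inj₂ dd | inj₂ de = inj₁ (endPentagon P db dc dd de)

    -- Growing an induced path.

    prepend : ∀ {S p₀ p₁ vs q} → InducedPath (p₀ ∷ p₁ ∷ vs) → All (_∈ S) (p₀ ∷ p₁ ∷ vs) →
              q ∈ S → p₀ ~ q → q ≢ p₁ → (∀ {w} → w ∈ vs → q ≁ w) → PathIn S (3 + length vs)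
    prepend path@(cons p₀~p₁ far _) ins q∈ p₀~q q≢p₁ q≁vs = pathIn
      (cons (sym G p₀~q)
        (((λ q~p₁ → no-triangle p₀~q q~p₁ (sym G p₀~p₁)) , q≢p₁)
        ∷ All.tabulate λ w∈ → q≁vs w∈ , λ { refl → proj₁ (All.lookup far w∈) p₀~q })
        path)
      (q∈ ∷ ins) ≤-refl

    -- The tail `us` leaves the pentagon at `p₃`. The given path has `4 + length us` vertices, so
    -- the new one is longer.
    close-pentagon : ∀ {S p₀ p₁ p₂ p₃ us q} → Pentagon S p₃ p₂ p₁ p₀ q → All (_∈ S) us →
                     InducedPath (p₀ ∷ p₁ ∷ p₂ ∷ p₃ ∷ us) → EndPentagon S ⊎ PathIn S (5 + length us)
    close-pentagon {us = []} P _ _ with some-pentagon P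
    ... | inj₁ end = inj₁ end
    ... | inj₂ (pathIn path ins long) = inj₂ (pathIn path ins (≤-trans (n≤1+n 5) long))
    close-pentagon {us = _ ∷ _} P us∈ (cons _ (_ ∷ _ ∷ far₀) (cons _ (_ ∷ far₁) (cons _ far₂ path))) =
      hanging-pentagon P path (All.tabulate λ w∈ → All.lookup us∈ w∈
        , ≢-sym (proj₂ (All.lookup far₂ w∈))
        , ≢-sym (proj₂ (All.lookup far₁ w∈))
        , ≢-sym (proj₂ (All.lookup far₀ w∈))
        -- `q` is not on the tail, since `p₀` is adjacent to `q` but to no vertex of the tail.
        , λ { refl → proj₁ (All.lookup far₀ w∈) (Pentagon.d~e P) })

    -- The girth keeps `q` off `p₁` and `p₂`, so `p₃` decides: an edge to it closes a pentagon, and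
    -- without one `no-long-cycle` excludes all later vertices.
    lengthen-by : ∀ {S p₀ p₁ vs q} → InducedPath (p₀ ∷ p₁ ∷ vs) → All (_∈ S) (p₀ ∷ p₁ ∷ vs) →
                  q ∈ S → p₀ ~ q → q ≢ p₁ → EndPentagon S ⊎ PathIn S (3 + length vs)
    lengthen-by {vs = []} path ins q∈ p₀~q q≢p₁ = inj₂ (prepend path ins q∈ p₀~q q≢p₁ λ ())
    lengthen-by {vs = _ ∷ []} path@(cons p₀~p₁ ((_ , p₀≢p₂) ∷ []) (cons p₁~p₂ _ _)) ins q∈ p₀~q q≢p₁ =
      inj₂ (prepend path ins q∈ p₀~q q≢p₁ λ { (here refl) q~p₂ →
        no-square p₀~q q~p₂ (sym G p₁~p₂) (sym G p₀~p₁) p₀≢p₂ q≢p₁ })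
    lengthen-by {vs = p₂ ∷ p₃ ∷ _} {q} path@(cons p₀~p₁ ((_ , p₀≢p₂) ∷ _) (cons p₁~p₂ _ (cons p₂~p₃ _ _)))
                ins@(p₀∈ ∷ p₁∈ ∷ p₂∈ ∷ p₃∈ ∷ us∈) q∈ p₀~q q≢p₁ with dec G q p₃
    ... | yes q~p₃ = close-pentagon
            (pentagon (sym G p₂~p₃) (sym G p₁~p₂) (sym G p₀~p₁) p₀~q q~p₃ p₃∈ p₂∈ p₁∈ p₀∈ q∈) us∈ path
    ... | no  q≁p₃ = inj₂ (prepend path ins q∈ p₀~q q≢p₁ λ where
            (here refl)         → q≁p₂
            (there (here refl)) → q≁p₃
            (there (there w∈))  → no-long-cycle path (sym G p₀~q)
              (λ q~p₁ → no-triangle p₀~q q~p₁ (sym G p₀~p₁)) q≁p₂ q≁p₃ w∈)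
      where
      q≁p₂ : q ≁ p₂
      q≁p₂ q~p₂ = no-square p₀~q q~p₂ (sym G p₁~p₂) (sym G p₀~p₁) p₀≢p₂ q≢p₁

    module _ {S : List V} (branching : ∀ {w} → w ∈ S → ∀ a → ∃ λ q → q ∈ S × w ~ q × q ≢ a) where

      lengthen : ∀ {vs} → InducedPath vs → All (_∈ S) vs → EndPentagon S ⊎ PathIn S (suc (length vs))
      lengthen (one {v}) (v∈ ∷ []) =
        -- Any neighbour will do here, so the vertex to be excluded is `v` itself.
        let _ , q∈ , v~q , _ = branching v∈ v in
        inj₂ (pathIn (cons (sym G v~q) [] one) (q∈ ∷ v∈ ∷ []) ≤-refl)
      lengthen {_ ∷ p₁ ∷ _} path@(cons _ _ _) ins@(p₀∈ ∷ _) =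
        let _ , q∈ , p₀~q , q≢p₁ = branching p₀∈ p₁ in lengthen-by path ins q∈ p₀~q q≢p₁

      -- Each round trades one unit of fuel for one more vertex; with no fuel left the path would
      -- have more than `n` vertices.
      find-end : ∀ fuel {k} → n < fuel + k → PathIn S k → EndPentagon S
      find-end zero n<k (pathIn p _ long) = contradiction (≤-trans long (path-length p)) (<⇒≱ n<k)
      find-end (suc fuel) {k} n< (pathIn p ins long) with lengthen p ins
      ... | inj₁ end = end
      ... | inj₂ (pathIn p′ ins′ long′) =
        find-end fuel (subst (n <_) (≡-sym (+-suc fuel k)) n<) (pathIn p′ ins′ (≤-trans (s≤s long) long′))

      end-pentagon : ∀ {v} → v ∈ S → EndPentagon S
      end-pentagon v∈ = find-end n (≤-reflexive (≡-sym (trans (+-suc n 0) (cong suc (+-identityʳ n))))) (pathIn one (v∈ ∷ []) ≤-refl)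

    -- Drawing four vertices of an end pentagon.

    module _ {S : List V} (E : EndPentagon S) where
      open EndPentagon E

      four : Fin 4 → V
      four zero                   = b
      four (suc zero)             = c
      four (suc (suc zero))       = d
      four (suc (suc (suc zero))) = e

      private
        open Pentagon cycle

        P₀ = cycle
        P₁ = rotate P₀
        P₂ = rotate P₁
        P₃ = rotate P₂
        P₄ = rotate P₃

        -- `b` and `e` are segments on rows 1 and 5 that start at the box of `a`; `c` and `d` fill
        -- the space between them and share row 3. The segments reach column 3, past `c` and `d`, to
        -- free their rays; `c` and `d` send theirs along rows 2 and 4. With row 0 for the ray of
        -- `a`, this needs blocks of six rows.
        l : Fin 4 → Box
        l zero                   = box 0 3 1 1 1
        l (suc zero)             = box 1 2 1 3 2
        l (suc (suc zero))       = box 1 2 3 5 4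
        l (suc (suc (suc zero))) = box 0 3 5 5 5

        locals : ∀ i → Local (l i)
        locals zero                   = local (valid z≤n ≤-refl ≤-refl) z<s z<s (toWitness {a? = 1 ≤? 5} _)
        locals (suc zero)             = local (valid (n≤1+n 1) (n≤1+n 1) (n≤1+n 2)) z<s z<s (toWitness {a? = 3 ≤? 5} _)
        locals (suc (suc zero))       = local (valid (n≤1+n 1) (n≤1+n 3) (n≤1+n 4)) z<s z<s ≤-refl
        locals (suc (suc (suc zero))) = local (valid z≤n ≤-refl ≤-refl) z<s z<s ≤-refl

        inner : ∀ i j → i ≢ j → Fits (four i ~ four j) (l i) (l j)
        inner zero zero i≢i = contradiction refl i≢i
        inner zero (suc zero) _ = fits-meet _ _ b~c
        inner zero (suc (suc zero)) _ = fits-apart _ _ (chord P₁)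
        inner zero (suc (suc (suc zero))) _ = fits-apart _ _ (chord P₄ ∘ sym G)
        inner (suc zero) zero _ = fits-meet _ _ (sym G b~c)
        inner (suc zero) (suc zero) i≢i = contradiction refl i≢i
        inner (suc zero) (suc (suc zero)) _ = fits-meet _ _ c~d
        inner (suc zero) (suc (suc (suc zero))) _ = fits-apart _ _ (chord P₂)
        inner (suc (suc zero)) zero _ = fits-apart _ _ (chord P₁ ∘ sym G)
        inner (suc (suc zero)) (suc zero) _ = fits-meet _ _ (sym G c~d)
        inner (suc (suc zero)) (suc (suc zero)) i≢i = contradiction refl i≢i
        inner (suc (suc zero)) (suc (suc (suc zero))) _ = fits-meet _ _ d~e
        inner (suc (suc (suc zero))) zero _ = fits-apart _ _ (chord P₄)
        inner (suc (suc (suc zero))) (suc zero) _ = fits-apart _ _ (chord P₂ ∘ sym G)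
        inner (suc (suc (suc zero))) (suc (suc zero)) _ = fits-meet _ _ (sym G d~e)
        inner (suc (suc (suc zero))) (suc (suc (suc zero))) i≢i = contradiction refl i≢i

        touch⁺ : ∀ i → four i ~ a → x₁ (l i) ≡ 0
        touch⁺ zero                   _   = refl
        touch⁺ (suc zero)             c~a = contradiction (sym G c~a) (chord P₀)
        touch⁺ (suc (suc zero))       d~a = contradiction d~a (chord P₃)
        touch⁺ (suc (suc (suc zero))) _   = refl

        touch⁻ : ∀ i → x₁ (l i) ≡ 0 → four i ~ a
        touch⁻ zero                   _ = sym G a~b
        touch⁻ (suc zero)             ()
        touch⁻ (suc (suc zero))       ()
        touch⁻ (suc (suc (suc zero))) _ = e~a

        a-old : ¬ ∃ λ i → a ≡ four i
        a-old (zero                   , a≡b) = ~⇒≢ a~b a≡b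
        a-old (suc zero               , a≡c) = opposite P₀ a≡c
        a-old (suc (suc zero)         , a≡d) = opposite P₃ (≡-sym a≡d)
        a-old (suc (suc (suc zero))   , a≡e) = ~⇒≢ e~a (≡-sym a≡e)

        neighbours : ∀ i {u} → u ∈ S → four i ~ u → u ≡ a ⊎ ∃ λ j → u ≡ four j
        neighbours zero u∈ b~u with deg-b u∈ b~u
        ... | inj₁ u≡a = inj₁ u≡a
        ... | inj₂ u≡c = inj₂ (suc zero , u≡c)
        neighbours (suc zero) u∈ c~u with deg-c u∈ c~u
        ... | inj₁ u≡b = inj₂ (zero , u≡b)
        ... | inj₂ u≡d = inj₂ (suc (suc zero) , u≡d)
        neighbours (suc (suc zero)) u∈ d~u with deg-d u∈ d~u
        ... | inj₁ u≡c = inj₂ (suc zero , u≡c)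
        ... | inj₂ u≡e = inj₂ (suc (suc (suc zero)) , u≡e)
        neighbours (suc (suc (suc zero))) u∈ e~u with deg-e u∈ e~u
        ... | inj₁ u≡d = inj₂ (suc (suc zero) , u≡d)
        ... | inj₂ u≡a = inj₁ u≡a

        outer : ∀ i {u} → u ∈ remove four S → u ≢ a → four i ≁ u
        outer i u∈ u≢a i~u with ∈-filter⁻ (¬? ∘ new? four) u∈
        ... | u∈S , ¬new = [ u≢a , ¬new ]′ (neighbours i u∈S i~u)

      pentagon-layout : Layout (remove four S) → Layout S
      pentagon-layout = attach {l = l} record
        { v-old  = ∈-filter⁺ (¬? ∘ new? four) a∈ a-old
        ; locals = locals
        ; inner  = inner
        ; touch⁺ = touch⁺
        ; touch⁻ = touch⁻
        ; outer  = outer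
        }

    -- Induction on the vertex set.

    other? : ∀ S w a → Dec (∃ λ q → q ∈ S × w ~ q × q ≢ a)
    other? S w a = any? λ q → (q ∈? S) ×-dec (dec G w q ×-dec ¬? (q ≟ a))

    Leaf : List V → Set
    Leaf S = ∃ λ w → ∃ λ a → w ∈ S × (∀ {q} → q ∈ S → w ~ q → q ≡ a)

    -- An isolated vertex counts as a leaf with any `a`, so the alternative says that all degrees in
    -- `S` are at least two.
    leaf? : ∀ S → Leaf S ⊎ (∀ {w} → w ∈ S → ∀ a → ∃ λ q → q ∈ S × w ~ q × q ≢ a)
    leaf? S with any? (λ w → any? (λ a → (w ∈? S) ×-dec ¬? (other? S w a)))
    ... | yes (w , a , w∈ , none) = inj₁ (w , a , w∈ , λ {q} q∈ w~q →
            decidable-stable (q ≟ a) λ q≢a → none (q , q∈ , w~q , q≢a))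
    ... | no  all = inj₂ λ {w} w∈ a → decidable-stable (other? S w a) λ none → all (w , a , w∈ , none)

    layout : ∀ S → Acc _<_ (length S) → Layout S
    layout [] _ = record { boxOf = λ _ → box 0 0 0 0 0 ; valids = λ () ; fit = λ () }
    layout S@(_ ∷ _) (acc rec) with leaf? S
    ... | inj₁ (w , a , w∈ , only) =
          leaf-layout only (layout _ (rec (remove-shorter (λ (_ : Fin 1) → w) S zero w∈)))
    ... | inj₂ branching =
          let E = end-pentagon branching (here refl) in
          pentagon-layout E (layout _ (rec (remove-shorter (four E) S zero (Pentagon.b∈ (EndPentagon.cycle E)))))

theorem9 : (n : ℕ) (G : SimpleGraph n) → ATFree G → GirthAtLeast G 5 → BoxicityAtMost G 2
theorem9 n G atFree girth = 2 , ≤-refl , record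
  { lo    = λ v → λ { zero → x₁ (boxOf v) ; (suc _) → y₁ (boxOf v) }
  ; hi    = λ v → λ { zero → x₂ (boxOf v) ; (suc _) → y₂ (boxOf v) }
  ; valid = λ v → λ
      { zero    → x₁≤x₂ (valids (∈-allFin v))
      ; (suc _) → ≤-trans (y₁≤ray (valids (∈-allFin v))) (ray≤y₂ (valids (∈-allFin v))) }
  ; adj⇔  = λ u v u≢v → let F = fit (∈-allFin u) (∈-allFin v) u≢v in
        (λ u~v → λ { zero → proj₁ (to F u~v) ; (suc _) → proj₂ (to F u~v) })
      , (λ meet → from F (meet zero , meet (suc zero)))
  }
  where
  open Layout (layout G atFree girth (allFin n) (<-wellFounded _))
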